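{- Let $\mathcal{AF}=\langle Args, Att\rangle$ be an abstract argumentation framework with $Args$ finite, let $a\in Args$, let $T$ be the dispute tree induced by $a$, and let $IS_T$ be the interpreted system associated with $T$. Let $p,o,e$ be strategy variables for the agents $Pro$, $Opp$, $Env$ respectively. Then the proponent has an ideal winning strategy $\sigma$ in $T$ (applied at the root $a$) if and only if $$IS_T\models \exists p\,\forall e\,\big(\phi_1\wedge\phi_2\wedge\phi_3\big),$$ where $$\phi_1=\forall o\; G\Big(\bigwedge_{i\in Args}\neg G(Opp_i)\Big),\qquad \phi_2=\bigwedge_{i\in Args}\Big(\exists o\,F(Pro_i)\Rightarrow \forall o\,G(\neg Opp_i)\Big),$$ $$\phi_3=\forall o\; G\Big(\Big(\bigvee_{i\in Args}Opp_i\Big)\Rightarrow \neg\exists o\,\big(\phi_{3.1}\wedge\phi_{3.2}\big)\Big),$$ $$\phi_{3.1}=\forall p\; G\Big(\bigwedge_{j\in Args}\neg G(Pro_j)\Big),\qquad \phi_{3.2}=\bigwedge_{j\in Args}\Big(\exists p\,F(Pro_j)\Rightarrow\forall p\,G(\neg Opp_j)\Big).$$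
   Context: **Argumentation frameworks and dispute trees.** An abstract argumentation framework is a pair $\langle Args, Att\rangle$ with $Args$ a set of arguments and $Att\subseteq Args\times Args$; $(x,y)\in Att$ means $x$ attacks $y$. The dispute tree $T$ induced by $a\in Args$ is the (possibly infinite) tree whose nodes carry arguments, such that: the root carries $a$ and is labelled P (played by the proponent); the children of a node carrying $y$ carry exactly the arguments $x$ with $(x,y)\in Att$ (one child for each such $x$); labels alternate along branches between P (proponent) and O (opponent), indicating who put the argument forward. A strategy is a partial function $\sigma: Args\rightharpoonup Args$ mapping an argument to one of its attackers, if there are any. Applying $\sigma$ from the root $a$ yields the subtree $T_\sigma$ of $T$ with root $a$ in which every node labelled P retains all of its children, and every node labelled O carrying argument $i$ retains at most one child, namely the one carrying $\sigma(i)$ (none if $\sigma(i)$ is undefined). $\sigma$ applied at root $a$ is an *admissible winning strategy* (for $a$) iff every opponent node in $T_\sigma$ has exactly one child and no argument is labelled in $T_\sigma$ by both the proponent and the opponent (i.e. no argument is carried both by a P-node and by an O-node of $T_\sigma$). An admissible winning strategy for an arbitrary argument $b$ is defined in the same way, using the dispute tree induced by $b$ (with the player who puts forward $b$ in the role of proponent). $\sigma$ applied at root $a$ is an *ideal winning strategy* iff $\sigma$ is an admissible winning strategy and there does not exist an admissible winning strategy $\sigma'$ for any argument $b\in Opp(T_\sigma)$, where $Opp(T_\sigma)$ is the set of all arguments played by the opponent in $T_\sigma$. **The interpreted system $IS_T$.** Agents: $Ag=\{Pro,Opp,Env\}$. Local states: $L_{Pro}=Args$; $L_{Opp}=Args\cup\{empty\}$;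 $L_{Env}$ consists of triples $(turn,last,attacksSeen)$ with $turn\in\{Pro,Opp\}$, $last\in Args$, $attacksSeen\subseteq Att$. A global state is an element of $L_{Pro}\times L_{Opp}\times L_{Env}$. The unique initial state is $s_0=(a, empty,(Opp,a,\emptyset))$. Actions: $Act_{Pro}=Act_{Opp}=\{attack_{xy}\mid (x,y)\in Att\}\cup\{nothing\}$, $Act_{Env}=\{nothing\}$; joint actions are triples in $Act_{Pro}\times Act_{Opp}\times Act_{Env}$. Protocols (enabled actions): for $i\in\{Pro,Opp\}$, when $Env$ is in state $(turn,last,\_)$, $P_i$ equals $\{attack_{x\,last}\mid (x,last)\in Att\}$ if $turn=i$ and this set is nonempty, and $\{nothing\}$ otherwise; $Env$ always has only $nothing$ enabled. Transitions (deterministic, componentwise): if $Env$ is in state $(Pro,y,S)$ and the joint action is $(attack_{xy},nothing,nothing)$, then the local state of $Pro$ becomes $x$, that of $Opp$ is unchanged, and that of $Env$ becomes $(Opp,x,S\cup\{(x,y)\})$; if $Env$ is in state $(Opp,y,S)$ and the joint action is $(nothing,attack_{xy},nothing)$, then the local state of $Opp$ becomes $x$, that of $Pro$ is unchanged, and that of $Env$ becomes $(Pro,x,S\cup\{(x,y)\})$; if all agents do $nothing$, the global state is unchanged. Atomic propositions: $Pro_x$, $Opp_x$ for $x\in Args$. At a reachable global state $g$: $Pro_x$ holds iff $Pro$'s local state is $x$ and $Env$'s local state has the form $(Opp,x,\_)$; $Opp_x$ holds iff $Opp$'s local state is $x$ and $Env$'s local state has the form $(Pro,x,\_)$. **Strategy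 Logic.** A strategy of agent $i\in\{Pro,Opp\}$ is a function $f_i: L_i\times L_{Env}\to Act_i$ choosing an enabled action, $f_i(l_i,l_e)\in P_i(l_i,l_e)$; a strategy of $Env$ is a function $f_{Env}:L_{Env}\to Act_{Env}$. An assignment $\chi$ maps strategy variables to strategies of the corresponding agent; $\chi[x\mapsto f]$ is $\chi$ with $x$ (re)assigned to $f$ (so an inner quantifier over $o$ or $p$ overrides an outer one). When all three variables $p,o,e$ are assigned, the $\chi$-$s$ play is the unique infinite path $\lambda=\lambda[0],\lambda[1],\dots$ with $\lambda[0]=s$ obtained when all agents follow the strategies assigned in $\chi$. Satisfaction $(IS_T,\chi,s)\models\phi$: atoms and Boolean connectives as usual; $(IS_T,\chi,s)\models\exists x\,\phi$ iff $(IS_T,\chi[x\mapsto f],s)\models\phi$ for some strategy $f$ of the agent of $x$; $\forall x$ is $\neg\exists x\neg$; $(IS_T,\chi,s)\models G\phi$ iff $(IS_T,\chi,\lambda[k])\models\phi$ for all $k\ge0$, and $(IS_T,\chi,s)\models F\phi$ iff $(IS_T,\chi,\lambda[k])\models\phi$ for some $k\ge0$, where $\lambda$ is the $\chi$-$s$ play. $IS_T\models\phi$ means $(IS_T,\emptyset,s_0)\models\phi$ with the empty assignment. -}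

module Defs where

open import Data.Fin using (Fin; combine; _≟_)
open import Data.Fin.Subset using (Subset; _∈_; _⊆_; _∪_; ⁅_⁆) renaming (⊥ to ∅)
open import Data.Fin.Subset.Properties using (x∈p∪q⁻; x∈⁅y⁆⇒x≡y; ∉⊥)
open import Data.Maybe using (Maybe; just; nothing)
open import Data.Nat using (ℕ; zero; suc; _*_)
open import Data.Product using (Σ; Σ-syntax; ∃; ∃-syntax; ∃!; _×_; _,_; proj₁)
open import Data.Sum using ([_,_]′)
open import Function using (_∘_)
open import Relation.Binary.PropositionalEquality using (_≡_; refl; sym; subst)
open import Relation.Nullary using (¬_; yes; no; contradiction)

-- A finite argumentation framework.  Subsets of Args × Args, with Args = Fin n,
-- are encoded as subsets of Fin (n * n) along the bijection `combine`; this
-- makes Att and the sets of seen attacks genuine finite sets, with decidable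
-- extensional equality.
record Framework : Set where
  field
    size : ℕ

  Args : Set
  Args = Fin size

  field
    Att : Subset (size * size)

  infix 4 _attacks_
  _attacks_ : Args → Args → Set
  x attacks y = combine x y ∈ Att

data Player : Set where
  Pro Opp : Player

opponent : Player → Player
opponent Pro = Opp
opponent Opp = Pro

module _ (AF : Framework) where
  open Framework AF

  -- `Node a l x` is the type of those nodes of the dispute tree induced by a
  -- that are labelled l and carry x.  A node is the branch leading to it, so a
  -- possibly infinite tree is given by an inductive type of nodes.
  data Node (a : Args) : Player → Args → Set where
    root  : Node a Pro a
    child : ∀ {l x y} → Node a (opponent l) y → x attacks y → Node a l x

  record TreeStrategy : Set where
    field
      move  : Args → Maybe Args
      sound : ∀ {x y} → move y ≡ just x → x attacks y

  open TreeStrategy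

  -- `Kept σ ν`: the node ν of T belongs to the subtree T_σ.
  data Kept {a : Args} (σ : TreeStrategy) : ∀ {l x} → Node a l x → Set where
    root   : Kept σ root
    every  : ∀ {x y} {ν : Node a Pro y} → Kept σ ν →
             (r : x attacks y) → Kept σ (child {l = Opp} ν r)
    chosen : ∀ {x y} {ν : Node a Opp y} → Kept σ ν →
             (r : x attacks y) → move σ y ≡ just x → Kept σ (child {l = Pro} ν r)

  Plays : Args → TreeStrategy → Player → Args → Set
  Plays a σ l x = Σ[ ν ∈ Node a l x ] Kept σ ν

  -- Distinct children of a node carry distinct arguments, so the children are
  -- counted by the arguments they carry.
  record AdmissibleWinning (a : Args) (σ : TreeStrategy) : Set where
    field
      one-child : ∀ {y} (ν : Node a Opp y) → Kept σ ν →
                  ∃! _≡_ λ x → Σ[ r ∈ x attacks y ] Kept σ (child {l = Pro} ν r)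
      no-clash  : ¬ (∃[ x ] Plays a σ Pro x × Plays a σ Opp x)

  record IdealWinning (a : Args) (σ : TreeStrategy) : Set where
    field
      admissible : AdmissibleWinning a σ
      safe       : ∀ b → Plays a σ Opp b → ¬ (∃[ σ′ ] AdmissibleWinning b σ′)

  data Agent : Set where
    player : Player → Agent
    Env    : Agent

  -- Irrelevance of the inclusion proof makes the state depend only on the set.
  record EnvState : Set where
    constructor env
    field
      turn        : Player
      last        : Args
      attacksSeen : Subset (size * size)
      .seen⊆Att   : attacksSeen ⊆ Att

  open EnvState

  -- `nothing` is the opponent's state `empty`.
  Local : Agent → Set
  Local (player Pro) = Args
  Local (player Opp) = Maybe Args
  Local Env          = EnvState

  record GlobalState : Set where
    constructor ⟨_,_,_⟩
    field
      pro  : Local (player Pro)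
      opp  : Local (player Opp)
      envˢ : Local Env

  open GlobalState

  initial : Args → GlobalState
  initial a = ⟨ a , nothing , env Opp a ∅ (λ x∈∅ → contradiction x∈∅ ∉⊥) ⟩

  data Action : Set where
    attack : (x y : Args) → .(x attacks y) → Action
    noop   : Action

  data EnvAction : Set where
    noop : EnvAction

  Act : Agent → Set
  Act (player _) = Action
  Act Env        = EnvAction

  data Enabled (i : Player) (e : EnvState) : Action → Set where
    attack : ∀ {x} → turn e ≡ i → (r : x attacks last e) →
             Enabled i e (attack x (last e) r)
    noop   : ¬ (turn e ≡ i × ∃[ x ] x attacks last e) → Enabled i e noop

  see-⊆ : ∀ {S} x y → S ⊆ Att → x attacks y → S ∪ ⁅ combine x y ⁆ ⊆ Att
  see-⊆ {S} x y S⊆ r =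
    [ S⊆ , (λ h → subst (_∈ Att) (sym (x∈⁅y⁆⇒x≡y (combine x y) h)) r) ]′
      ∘ x∈p∪q⁻ S ⁅ combine x y ⁆

  -- Joint actions that can never be enabled leave the state unchanged; this
  -- choice is immaterial.
  transition : GlobalState → Act (player Pro) × Act (player Opp) × Act Env → GlobalState
  transition g@(⟨ _ , o , env Pro y S S⊆ ⟩) (attack x y′ r , noop , noop) with y′ ≟ y
  ... | yes refl = ⟨ x , o , env Opp x (S ∪ ⁅ combine x y ⁆) (see-⊆ x y S⊆ r) ⟩
  ... | no _     = g
  transition g@(⟨ p , _ , env Opp y S S⊆ ⟩) (noop , attack x y′ r , noop) with y′ ≟ y
  ... | yes refl = ⟨ p , just x , env Pro x (S ∪ ⁅ combine x y ⁆) (see-⊆ x y S⊆ r) ⟩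
  ... | no _     = g
  transition g _ = g

  -- The valuation: `Holds Pro x g` is Pro_x at g, and `Holds Opp x g` is Opp_x.
  Holds : Player → Args → GlobalState → Set
  Holds Pro x g = pro g ≡ x × turn (envˢ g) ≡ Opp × last (envˢ g) ≡ x
  Holds Opp x g = opp g ≡ just x × turn (envˢ g) ≡ Pro × last (envˢ g) ≡ x

  Strategy : Agent → Set
  Strategy (player i) =
    Σ[ f ∈ (Local (player i) → EnvState → Action) ] (∀ l e → Enabled i e (f l e))
  Strategy Env = EnvState → EnvAction

  data Var : Set where
    p o e : Var

  agent : Var → Agent
  agent p = player Pro
  agent o = player Opp
  agent e = Env

  Assignment : Set
  Assignment = (v : Var) → Maybe (Strategy (agent v))

  emptyAssignment : Assignment
  emptyAssignment _ = nothing

  _[_↦_] : Assignment → (v : Var) → Strategy (agent v) → Assignment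
  (χ [ p ↦ f ]) p = just f
  (χ [ o ↦ f ]) o = just f
  (χ [ e ↦ f ]) e = just f
  (χ [ _ ↦ f ]) v = χ v

  Profile : Set
  Profile = (v : Var) → Strategy (agent v)

  jointAction : Profile → GlobalState → Act (player Pro) × Act (player Opp) × Act Env
  jointAction π g =
    proj₁ (π p) (pro g) (envˢ g) , proj₁ (π o) (opp g) (envˢ g) , π e (envˢ g)

  play : Profile → GlobalState → ℕ → GlobalState
  play π s zero    = s
  play π s (suc k) = transition (play π s k) (jointAction π (play π s k))

  infixr 6 _∧′_
  infixr 5 _⇒′_
  infix  7 ¬′_

  data Formula : Set where
    atom      : Player → Args → Formula
    ¬′_       : Formula → Formula
    _∧′_ _⇒′_ : Formula → Formula → Formula
    ⋀′ ⋁′     : (Args → Formula) → Formula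
    ∃′        : Var → Formula → Formula
    G F       : Formula → Formula

  ∀′ : Var → Formula → Formula
  ∀′ v φ = ¬′ ∃′ v (¬′ φ)

  -- Temporal operators are only meaningful once all variables are assigned;
  -- π is then the (unique) profile of strategies assigned by χ.
  Sat : Assignment → GlobalState → Formula → Set
  Sat χ s (atom i x) = Holds i x s
  Sat χ s (¬′ φ)     = ¬ Sat χ s φ
  Sat χ s (φ ∧′ ψ)   = Sat χ s φ × Sat χ s ψ
  Sat χ s (φ ⇒′ ψ)   = Sat χ s φ → Sat χ s ψ
  Sat χ s (⋀′ φ)     = ∀ i → Sat χ s (φ i)
  Sat χ s (⋁′ φ)     = ∃[ i ] Sat χ s (φ i)
  Sat χ s (∃′ v φ)   = ∃[ f ] Sat (χ [ v ↦ f ]) s φ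
  Sat χ s (G φ)      = Σ[ π ∈ Profile ] (∀ v → χ v ≡ just (π v)) ×
                         (∀ k → Sat χ (play π s k) φ)
  Sat χ s (F φ)      = Σ[ π ∈ Profile ] (∀ v → χ v ≡ just (π v)) ×
                         (∃[ k ] Sat χ (play π s k) φ)

  -- Truth in the interpreted system of the dispute tree induced by a.
  TrueInIS : Args → Formula → Set
  TrueInIS a φ = Sat emptyAssignment (initial a) φ

  φ₁ φ₂ φ₃ φ₃₁ φ₃₂ : Formula
  φ₁  = ∀′ o (G (⋀′ λ i → ¬′ G (atom Opp i)))
  φ₂  = ⋀′ λ i → ∃′ o (F (atom Pro i)) ⇒′ ∀′ o (G (¬′ atom Opp i))
  φ₃₁ = ∀′ p (G (⋀′ λ j → ¬′ G (atom Pro j)))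
  φ₃₂ = ⋀′ λ j → ∃′ p (F (atom Pro j)) ⇒′ ∀′ p (G (¬′ atom Opp j))
  φ₃  = ∀′ o (G (⋁′ (λ i → atom Opp i) ⇒′ ¬′ ∃′ o (φ₃₁ ∧′ φ₃₂)))

  idealFormula : Formula
  idealFormula = ∃′ p (∀′ e (φ₁ ∧′ φ₂ ∧′ φ₃))

{-# OPTIONS --safe #-}

-- Both sides are equivalent to the decidable existence of an admissible set Q
-- (conflict-free and attacking each of its attackers) which contains a and none
-- of whose attackers lies in an admissible set.  From a winning strategy, of
-- either kind, Q is the set of arguments its owner can be brought to play;
-- conversely, answering every attack from within Q wins.  Memory in the
-- strategies of IS_T is harmless: to see that every attack on a reachable
-- argument x can be played, a rival strategy reaching x is altered at all states
-- where x is the last argument, and the altered play still reaches x.  Reachable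
-- sets are decidable only up to double negation, which the decidability of the
-- existence of Q removes at the end.
module Submission where

open import Defs renaming (_[_↦_] to assign)
open import Data.Fin using (combine; _≟_)
open import Data.Fin.Properties using (all?; any?; sequence)
open import Data.Fin.Subset using (Subset; _∈_) renaming (⊥ to ∅)
open import Data.Fin.Subset.Properties using (_∈?_; anySubset?)
open import Data.Maybe using (Maybe; just; nothing)
open import Data.Maybe.Properties using (just-injective)
open import Data.Nat using (zero; suc)
open import Data.Product using (Σ-syntax; ∃; ∃-syntax; _×_; _,_; proj₁; proj₂)
open import Data.Sum using (_⊎_; inj₁; inj₂)
open import Data.Vec using (tabulate)
open import Data.Vec.Properties using ([]=⇒lookup; lookup⇒[]=; lookup∘tabulate)
open import Effect.Monad using (RawMonad)
open import Function using (_∘_)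
open import Function.Bundles using (_⇔_; mk⇔)
open import Level using (0ℓ)
open import Relation.Binary.Definitions using (DecidableEquality)
open import Relation.Binary.PropositionalEquality
  using (_≡_; _≢_; refl; sym; trans; cong; cong₂; subst)
open import Relation.Nullary
  using (¬_; Dec; does; yes; no; contradiction; ¬?; _×-dec_; _→-dec_)
open import Relation.Nullary.Decidable using (dec-true; decidable-stable; ¬¬-excluded-middle)
open import Relation.Nullary.Negation using (¬¬-Monad; ¬¬-map)
open import Relation.Unary using (Pred; _≐_)

open GlobalState
open EnvState
open TreeStrategy
open AdmissibleWinning
open IdealWinning

-- Excluded middle for each element holds under double negation, and `sequence` moves finitely many
-- double negations outside the quantifier; a decided predicate is then tabulated.
¬¬-subset : ∀ {n} (P : Pred _ 0ℓ) → ¬ ¬ (Σ[ Q ∈ Subset n ] P ≐ (_∈ Q))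
¬¬-subset {n} P =
  ¬¬-map comprehension (sequence (RawMonad.rawApplicative ¬¬-Monad) λ _ → ¬¬-excluded-middle)
  where
  comprehension : (∀ x → Dec (P x)) → Σ[ Q ∈ Subset n ] P ≐ (_∈ Q)
  comprehension P? = tabulate (does ∘ P?) , to , from
    where
    to : ∀ {x} → P x → x ∈ tabulate (does ∘ P?)
    to {x} px = lookup⇒[]= x _ (trans (lookup∘tabulate _ x) (dec-true (P? x) px))
    from : ∀ {x} → x ∈ tabulate (does ∘ P?) → P x
    from {x} x∈ with P? x | trans (sym (lookup∘tabulate (does ∘ P?) x)) ([]=⇒lookup x∈)
    ... | yes px | _  = px
    ... | no _   | ()

_≟ₚ_ : DecidableEquality Player
Pro ≟ₚ Pro = yes refl
Pro ≟ₚ Opp = no λ ()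
Opp ≟ₚ Pro = no λ ()
Opp ≟ₚ Opp = yes refl

opponent-involutive : ∀ i → opponent (opponent i) ≡ i
opponent-involutive Pro = refl
opponent-involutive Opp = refl

opponent≢ : ∀ i → opponent i ≢ i
opponent≢ Pro ()
opponent≢ Opp ()

module _ (AF : Framework) where
  open Framework AF

  -- Admissible and ideal sets of arguments.

  attacks? : ∀ x y → Dec (x attacks y)
  attacks? x y = combine x y ∈? Att

  -- Stated for predicates, because the sets of arguments reached in trees and plays come without a
  -- decision procedure.
  Admissible : Pred Args 0ℓ → Set
  Admissible P = (∀ x y → P x → P y → ¬ x attacks y) ×
                 (∀ x y → P x → y attacks x → ∃[ z ] P z × z attacks y)

  AdmissibleSet : Subset size → Set
  AdmissibleSet Q = Admissible (_∈ Q)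

  Accepted : Args → Set
  Accepted x = ∃[ Q ] x ∈ Q × AdmissibleSet Q

  Ideal : Args → Subset size → Set
  Ideal a Q = a ∈ Q × AdmissibleSet Q × (∀ x y → x ∈ Q → y attacks x → ¬ Accepted y)

  admissible? : ∀ Q → Dec (AdmissibleSet Q)
  admissible? Q =
    (all? λ x → all? λ y → (x ∈? Q) →-dec ((y ∈? Q) →-dec ¬? (attacks? x y))) ×-dec
    (all? λ x → all? λ y → (x ∈? Q) →-dec (attacks? y x →-dec
      any? λ z → (z ∈? Q) ×-dec attacks? z y))

  accepted? : ∀ x → Dec (Accepted x)
  accepted? x = anySubset? λ Q → (x ∈? Q) ×-dec admissible? Q

  ideal? : ∀ a → Dec (∃ (Ideal a))
  ideal? a = anySubset? λ Q → (a ∈? Q) ×-dec (admissible? Q ×-dec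
    (all? λ x → all? λ y → (x ∈? Q) →-dec (attacks? y x →-dec ¬? (accepted? y))))

  admissible-resp-≐ : ∀ {P Q} → P ≐ Q → Admissible P → Admissible Q
  admissible-resp-≐ (P⊆Q , Q⊆P) (free , defended) =
    (λ x y qx qy → free x y (Q⊆P qx) (Q⊆P qy)) ,
    (λ x y qx r → let z , pz , r′ = defended x y (Q⊆P qx) r in z , P⊆Q pz , r′)

  accepted : ∀ {P x} → P x → Admissible P → ¬ ¬ Accepted x
  accepted {P} px adm =
    ¬¬-map (λ (Q , P≐Q) → Q , proj₁ P≐Q px , admissible-resp-≐ P≐Q adm) (¬¬-subset P)

  ideal : ∀ {P a} → P a → Admissible P → (∀ x y → P x → y attacks x → ¬ Accepted y) →
          ∃ (Ideal a)
  ideal {P} {a} pa adm safe′ = decidable-stable (ideal? a) (¬¬-map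
    (λ (Q , P≐Q) → Q , proj₁ P≐Q pa , admissible-resp-≐ P≐Q adm ,
                   λ x y x∈Q → safe′ x y (proj₂ P≐Q x∈Q))
    (¬¬-subset P))

  -- The common invariant of trees and plays. Here `Pro` stands for the owner of `Q`, which in the
  -- inner game of `φ₃` is the agent `Opp`.
  Member : Subset size → Player → Args → Set
  Member Q Pro x = x ∈ Q
  Member Q Opp y = ∃[ x ] x ∈ Q × y attacks x

  ¬both-members : ∀ {Q} → AdmissibleSet Q → ∀ {x} → Member Q Pro x → ¬ Member Q Opp x
  ¬both-members (free , _) x∈Q (y , y∈Q , r) = free _ y x∈Q y∈Q r

  -- Dispute trees.

  -- Proponent nodes keep all children, so every attacker of a proponent argument is an opponent
  -- argument. An attack inside the set would therefore be a clash, and the unique reply to an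
  -- attacker is a defender.
  winning⇒admissible : ∀ {b σ} → AdmissibleWinning AF b σ → Admissible (Plays AF b σ Pro)
  winning⇒admissible {b} {σ} w = free , defended
    where
    free : ∀ x y → Plays AF b σ Pro x → Plays AF b σ Pro y → ¬ x attacks y
    free x y px (_ , k) r = no-clash w (x , px , _ , every k r)
    defended : ∀ x y → Plays AF b σ Pro x → y attacks x →
               ∃[ z ] Plays AF b σ Pro z × z attacks y
    defended x y (_ , k) r with one-child w _ (every k r)
    ... | z , (r′ , k′) , _ = z , (_ , k′) , r′

  -- Left undefined where `Q` offers no attacker; for admissible `Q` containing the root, no kept
  -- opponent node carries such an argument.
  defence : Subset size → TreeStrategy AF
  defence Q = record { move = proj₁ ∘ choose ; sound = λ {x} {y} → proj₂ (choose y) }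
    where
    choose : ∀ y → Σ[ m ∈ Maybe Args ] (∀ {x} → m ≡ just x → x attacks y)
    choose y with any? (λ z → (z ∈? Q) ×-dec attacks? z y)
    ... | yes (z , _ , r) = just z , λ { refl → r }
    ... | no _            = nothing , λ ()

  defence-complete : ∀ {Q y z} → z ∈ Q → z attacks y →
                     ∃[ x ] move (defence Q) y ≡ just x × x attacks y
  defence-complete {Q} {y} {z} z∈Q r with any? (λ z → (z ∈? Q) ×-dec attacks? z y)
  ... | yes (x , _ , r′) = x , refl , r′
  ... | no ¬z            = contradiction (z , z∈Q , r) ¬z

  defence-sound : ∀ {Q y x} → move (defence Q) y ≡ just x → x ∈ Q
  defence-sound {Q} {y} eq with any? (λ z → (z ∈? Q) ×-dec attacks? z y)
  defence-sound refl | yes (_ , x∈Q , _) = x∈Q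
  defence-sound ()   | no _

  module _ {b Q} (b∈Q : b ∈ Q) (adm : AdmissibleSet Q) where

    kept-member : ∀ {l x} {ν : Node AF b l x} → Kept AF (defence Q) ν → Member Q l x
    kept-member root            = b∈Q
    kept-member (every k r)     = _ , kept-member k , r
    kept-member (chosen k r eq) = defence-sound eq

    defence-winning : AdmissibleWinning AF b (defence Q)
    defence-winning .one-child {y} ν k with kept-member k
    ... | x , x∈Q , r with proj₂ adm x y x∈Q r
    ...   | z , z∈Q , r′ with defence-complete z∈Q r′
    ...     | m , eq , r″ =
      m , (r″ , chosen k r″ eq) ,
      -- A kept child of an opponent node can only be `chosen`, so its argument is again the value
      -- of `move`.
      λ { (_ , chosen _ _ eq′) → just-injective (trans (sym eq) eq′) }
    defence-winning .no-clash (_ , (_ , k) , _ , k′) =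
      ¬both-members adm (kept-member k) (kept-member k′)

  -- An attacker of a proponent argument is played by the opponent; were it accepted, `defence`
  -- would win from it, against `safe`.
  idealWinning⇒ideal : ∀ {a σ} → IdealWinning AF a σ → ∃ (Ideal a)
  idealWinning⇒ideal w = ideal (root , root) (winning⇒admissible (admissible w))
    λ { x y (_ , k) r (_ , y∈Q , adm) →
        safe w y (_ , every k r) (_ , defence-winning y∈Q adm) }

  ideal⇒idealWinning : ∀ {a} → ∃ (Ideal a) → ∃ (IdealWinning AF a)
  ideal⇒idealWinning (Q , a∈Q , adm , safe′) = defence Q , record
    { admissible = defence-winning a∈Q adm
    ; safe = λ { b (_ , k) (_ , w) → let x , x∈Q , r = kept-member a∈Q adm k in
                 accepted (root , root) (winning⇒admissible w) (safe′ x b x∈Q r) } }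

  -- Plays of the interpreted system.

  State : Set
  State = GlobalState AF

  playerStrategy : Player → Set
  playerStrategy i = Strategy AF (player i)

  step : Profile AF → State → State
  step π s = transition AF s (jointAction AF π s)

  action : Profile AF → Player → State → Action AF
  action π Pro s = proj₁ (π p) (pro s) (envˢ s)
  action π Opp s = proj₁ (π o) (opp s) (envˢ s)

  holds⇒turn : ∀ i {x s} → Holds AF i x s → turn (envˢ s) ≡ opponent i
  holds⇒turn Pro (_ , t , _) = t
  holds⇒turn Opp (_ , t , _) = t

  holds⇒last : ∀ i {x s} → Holds AF i x s → last (envˢ s) ≡ x
  holds⇒last Pro (_ , _ , l) = l
  holds⇒last Opp (_ , _ , l) = l

  rival⇒turn : ∀ i {x s} → Holds AF (opponent i) x s → turn (envˢ s) ≡ i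
  rival⇒turn i holds = trans (holds⇒turn (opponent i) holds) (opponent-involutive i)

  data Progress (π : Profile AF) (s : State) : Set where
    blocked : action π (turn (envˢ s)) s ≡ noop → step π s ≡ s → Progress π s
    moved   : ∀ {x} (r : x attacks last (envˢ s)) →
              action π (turn (envˢ s)) s ≡ attack x (last (envˢ s)) r →
              Holds AF (turn (envˢ s)) x (step π s) → Progress π s

  enabled-idle : ∀ {i E α} → Enabled AF i E α → turn E ≢ i → α ≡ noop
  enabled-idle (attack t _) t≢ = contradiction t t≢
  enabled-idle (noop _)     _  = refl

  enabled-active : ∀ {E α} → Enabled AF (turn E) E α →
                   α ≡ noop ⊎ (∃[ x ] Σ[ r ∈ x attacks last E ] α ≡ attack x (last E) r)
  enabled-active (attack _ r) = inj₂ (_ , r , refl)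
  enabled-active (noop _)     = inj₁ refl

  jointFor : Player → Action AF → Act AF (player Pro) × Act AF (player Opp) × Act AF Env
  jointFor Pro α = α , noop , noop
  jointFor Opp α = noop , α , noop

  env-noop : (α : EnvAction AF) → α ≡ noop
  env-noop noop = refl

  action-enabled : ∀ π i s → Enabled AF i (envˢ s) (action π i s)
  action-enabled π Pro s = proj₂ (π p) (pro s) (envˢ s)
  action-enabled π Opp s = proj₂ (π o) (opp s) (envˢ s)

  -- The protocol forces `noop` on the environment and on the player not on turn.
  joint-action : ∀ π s i → turn (envˢ s) ≡ i →
                 jointAction AF π s ≡ jointFor i (action π i s)
  joint-action π s Pro refl = cong (action π Pro s ,_)
    (cong₂ _,_ (enabled-idle (action-enabled π Opp s) λ ()) (env-noop _))
  joint-action π s Opp refl =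
    cong₂ _,_ (enabled-idle (action-enabled π Pro s) λ ()) (cong (action π Opp s ,_) (env-noop _))

  transition-noop : ∀ s → transition AF s (noop , noop , noop) ≡ s
  transition-noop ⟨ _ , _ , env Pro _ _ _ ⟩ = refl
  transition-noop ⟨ _ , _ , env Opp _ _ _ ⟩ = refl

  transition-attack : ∀ s x (r : x attacks last (envˢ s)) → let i = turn (envˢ s) in
    Holds AF i x (transition AF s (jointFor i (attack x (last (envˢ s)) r)))
  transition-attack ⟨ _ , _ , env Pro y _ _ ⟩ x r with y ≟ y
  ... | yes refl = refl , refl , refl
  ... | no y≢y   = contradiction refl y≢y
  transition-attack ⟨ _ , _ , env Opp y _ _ ⟩ x r with y ≟ y
  ... | yes refl = refl , refl , refl
  ... | no y≢y   = contradiction refl y≢y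

  jointFor-noop : ∀ i → jointFor i noop ≡ (noop , noop , noop)
  jointFor-noop Pro = refl
  jointFor-noop Opp = refl

  progress : ∀ π s → Progress π s
  progress π s with enabled-active (action-enabled π (turn (envˢ s)) s)
  ... | inj₁ eq = blocked eq (trans
    (cong (transition AF s) (trans (joint-action π s _ refl)
      (trans (cong (jointFor _) eq) (jointFor-noop _))))
    (transition-noop s))
  ... | inj₂ (x , r , eq) = moved r eq (subst (Holds AF (turn (envˢ s)) x ∘ transition AF s)
    (sym (trans (joint-action π s _ refl) (cong (jointFor _) eq)))
    (transition-attack s x r))

  blocked-forever : ∀ {π s} → step π s ≡ s → ∀ k → play AF π s k ≡ s
  blocked-forever eq zero    = refl
  blocked-forever {π} eq (suc k) = trans (cong (step π) (blocked-forever eq k)) eq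

  local : ∀ i → State → Local AF (player i)
  local Pro = pro
  local Opp = opp

  act : ∀ i → playerStrategy i → State → Action AF
  act i f s = proj₁ f (local i s) (envˢ s)

  -- Indexing by the owner `i` of the fixed strategy lets one argument serve both the outer game
  -- (`i` is `Pro`) and the inner game of `φ₃` (`i` is `Opp`).
  duel : ∀ i → playerStrategy i → playerStrategy (opponent i) → Strategy AF Env → Profile AF
  duel Pro f g h p = f
  duel Pro f g h o = g
  duel Opp f g h p = g
  duel Opp f g h o = f
  duel _   f g h e = h

  action-own : ∀ i {f g h} s → action (duel i f g h) i s ≡ act i f s
  action-own Pro s = refl
  action-own Opp s = refl

  action-rival : ∀ i {f g h} s → action (duel i f g h) (opponent i) s ≡ act (opponent i) g s
  action-rival Pro s = refl
  action-rival Opp s = refl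

  step-rival-cong : ∀ i {f} g g′ {h} s → act (opponent i) g s ≡ act (opponent i) g′ s →
                    step (duel i f g h) s ≡ step (duel i f g′ h) s
  step-rival-cong Pro _ _ s eq = cong (λ α → transition AF s (_ , α , _)) eq
  step-rival-cong Opp _ _ s eq = cong (λ α → transition AF s (α , _)) eq

  moved-by : ∀ π s {i x} → turn (envˢ s) ≡ i → (r : x attacks last (envˢ s)) →
             action π i s ≡ attack x (last (envˢ s)) r → Holds AF i x (step π s)
  moved-by π s refl r eq with progress π s
  ... | blocked eq′ _ = contradiction (trans (sym eq) eq′) λ ()
  ... | moved _ eq′ h with refl ← trans (sym eq) eq′ = h

  -- Winning positions.

  -- The content of `φ₁` and `φ₃₁`, with `A` the strategies of the quantified variable; the doubled
  -- `play` mirrors the nested `G`.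
  Unblocked : {A : Set} → Player → (A → Profile AF) → State → Set
  Unblocked j π s = ∀ g k x → ¬ (∀ m → Holds AF j x (play AF (π g) (play AF (π g) s k) m))

  -- The content of `φ₂` and `φ₃₂`; two strategies occur because each side of the implication
  -- quantifies separately.
  Disjoint : {A : Set} → (A → Profile AF) → State → Set
  Disjoint π s = ∀ x g g′ k k′ →
    Holds AF Pro x (play AF (π g) s k) → ¬ Holds AF Opp x (play AF (π g′) s k′)

  Reaches : {A : Set} → (A → Profile AF) → State → Player → Args → Set
  Reaches π s i x = ∃[ g ] ∃[ k ] Holds AF i x (play AF (π g) s k)

  disjoint-players : ∀ i {A} {π : A → Profile AF} {s x} → Disjoint π s →
                     Reaches π s i x → ¬ Reaches π s (opponent i) x
  disjoint-players Pro d (g , k , h) (g′ , k′ , h′) = d _ g g′ k k′ h h′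
  disjoint-players Opp d (g , k , h) (g′ , k′ , h′) = d _ g′ g k′ k h′ h

  At : Player → Args → EnvState AF → Set
  At i x E = turn E ≡ i × last E ≡ x

  at? : ∀ i x E → Dec (At i x E)
  at? i x E = (turn E ≟ₚ i) ×-dec (last E ≟ x)

  module _ (i : Player) (x y : Args) (r : y attacks x) (g : playerStrategy i) where

    deviation : playerStrategy i
    deviation = (λ l E → proj₁ (choose l E)) , (λ l E → proj₂ (choose l E))
      where
      choose : ∀ l E → ∃ (Enabled AF i E)
      choose l E with at? i x E
      ... | yes (t , refl) = _ , attack t r
      ... | no _           = proj₁ g l E , proj₂ g l E

    deviation-at : ∀ l E → At i x E →
                   Σ[ r′ ∈ y attacks last E ] proj₁ deviation l E ≡ attack y (last E) r′
    deviation-at l E at with at? i x E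
    ... | yes (_ , refl) = r , refl
    ... | no ¬at         = contradiction at ¬at

    deviation-elsewhere : ∀ l E → ¬ At i x E → proj₁ deviation l E ≡ proj₁ g l E
    deviation-elsewhere l E ¬at with at? i x E
    ... | yes at = contradiction at ¬at
    ... | no _   = refl

  module _ (i : Player) (f : playerStrategy i) (h : Strategy AF Env) (s : State) where

    duels : playerStrategy (opponent i) → Profile AF
    duels g = duel i f g h

    reaches-attackers : ∀ {x y} → Reaches duels s i x → y attacks x →
                        Reaches duels s (opponent i) y
    reaches-attackers {x} {y} (g , k , holds) r = g′ , suc (proj₁ visit) , arrive
      where
      g′ : playerStrategy (opponent i)
      g′ = deviation (opponent i) x y r g
      Visited : State → Set
      Visited u = At (opponent i) x (envˢ u)
      -- The two strategies differ only at visited states, so the plays agree as long as the altered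
      -- one has made no visit.
      unchanged-until-visit : ∀ k → play AF (duels g) s k ≡ play AF (duels g′) s k ⊎
                              ∃ (λ k′ → Visited (play AF (duels g′) s k′))
      unchanged-until-visit zero = inj₁ refl
      unchanged-until-visit (suc k) with unchanged-until-visit k
      ... | inj₂ v  = inj₂ v
      ... | inj₁ eq with at? (opponent i) x (envˢ (play AF (duels g′) s k))
      ...   | yes at = inj₂ (k , at)
      ...   | no ¬at = inj₁ (trans (cong (step (duels g)) eq)
              (step-rival-cong i g g′ u (sym
                (deviation-elsewhere (opponent i) x y r g (local (opponent i) u) (envˢ u) ¬at))))
        where u = play AF (duels g′) s k
      visit : ∃ (λ k′ → Visited (play AF (duels g′) s k′))
      visit with unchanged-until-visit k
      ... | inj₂ v  = v
      -- If the plays still agree at `k`, the state where `x` has just been played is itself a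
      -- visit.
      ... | inj₁ eq = k , subst Visited eq (holds⇒turn i holds , holds⇒last i holds)
      u : State
      u = play AF (duels g′) s (proj₁ visit)
      arrive : Holds AF (opponent i) y (step (duels g′) u)
      arrive with deviation-at (opponent i) x y r g (local (opponent i) u) (envˢ u) (proj₂ visit)
      ... | r′ , eq = moved-by (duels g′) u (proj₁ (proj₂ visit)) r′ (trans (action-rival i u) eq)

    -- Without a reply to `y` the play would stand still there forever, which `Unblocked` excludes;
    -- the reply is reached by the same rival strategy one step later.
    reached-attacked : ∀ {y} → Unblocked (opponent i) duels s → Reaches duels s (opponent i) y →
                       ∃[ z ] Reaches duels s i z × z attacks y
    reached-attacked {y} unblocked (g , k , holds) with progress (duels g) (play AF (duels g) s k)
    ... | blocked _ stop = contradiction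
      (λ m → subst (Holds AF (opponent i) y) (sym (blocked-forever stop m)) holds)
      (unblocked g k y)
    ... | moved {z} r _ holds′ = z ,
      (g , suc k , subst (λ j → Holds AF j z (play AF (duels g) s (suc k)))
        (rival⇒turn i holds) holds′) ,
      subst (z attacks_) (holds⇒last (opponent i) holds) r

    -- If a reached `x` attacked a reached `y`, the rival could also play `x`, contradicting
    -- disjointness.
    reaches-admissible : Unblocked (opponent i) duels s → Disjoint duels s →
                         Admissible (Reaches duels s i)
    reaches-admissible unblocked disjoint =
      (λ x y rx ry r → disjoint-players i disjoint rx (reaches-attackers ry r)) ,
      (λ x y rx r → reached-attacked unblocked (reaches-attackers rx r))

  -- Defending from within an admissible set.

  module _ (Q : Subset size) (i : Player) where

    guard : playerStrategy i
    guard = (λ l E → proj₁ (choose E)) , (λ l E → proj₂ (choose E))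
      where
      choose : ∀ E → ∃ (Enabled AF i E)
      choose E with turn E ≟ₚ i
      ... | no t≢ = noop , noop (t≢ ∘ proj₁)
      ... | yes t with any? (λ z → (z ∈? Q) ×-dec attacks? z (last E))
      ...   | yes (_ , _ , r) = _ , attack t r
      -- The protocol allows `noop` only if no attack exists at all, so an attacker outside `Q` must
      -- be the fallback.
      ...   | no _ with any? (λ z → attacks? z (last E))
      ...     | yes (_ , r) = _ , attack t r
      ...     | no ¬r       = noop , noop (¬r ∘ proj₂)

    guard-defends : ∀ l E {z} → turn E ≡ i → z ∈ Q → z attacks last E →
      ∃[ x ] x ∈ Q × Σ[ r ∈ x attacks last E ] proj₁ guard l E ≡ attack x (last E) r
    guard-defends l E t z∈Q r with turn E ≟ₚ i
    ... | no t≢ = contradiction t t≢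
    ... | yes _ with any? (λ z → (z ∈? Q) ×-dec attacks? z (last E))
    ...   | yes (x , x∈Q , r′) = x , x∈Q , r′ , refl
    ...   | no ¬z              = contradiction (_ , z∈Q , r) ¬z

  module _ {Q} (adm : AdmissibleSet Q) (i : Player) (h : Strategy AF Env) where

    guarded : playerStrategy (opponent i) → Profile AF
    guarded g = duel i (guard Q i) g h

    guard-replies : ∀ g {y s} → Holds AF (opponent i) y s → Member Q Opp y →
                    ∃[ z ] z ∈ Q × Holds AF i z (step (guarded g) s)
    guard-replies g {y} {s} holds (x , x∈Q , r)
      with refl ← holds⇒last (opponent i) holds
         | z , z∈Q , r′ ← proj₂ adm x y x∈Q r
      with w , w∈Q , r″ , eq ← guard-defends Q i (local i s) (envˢ s) (rival⇒turn i holds) z∈Q r′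
      = w , w∈Q , moved-by (guarded g) s (rival⇒turn i holds) r″ (trans (action-own i s) eq)

    data Guarded (s : State) : Set where
      own   : ∀ {x} → Holds AF i x s → Member Q Pro x → Guarded s
      rival : ∀ {y} → Holds AF (opponent i) y s → Member Q Opp y → Guarded s

    step-guarded : ∀ g {s} → Guarded s → Guarded (step (guarded g) s)
    step-guarded g (rival holds m) = let z , z∈Q , holds′ = guard-replies g holds m in own holds′ z∈Q
    step-guarded g {s} (own {x} holds x∈Q) with progress (guarded g) s
    ... | blocked _ stop = subst Guarded (sym stop) (own holds x∈Q)
    ... | moved {y} r _ holds′ = rival
      (subst (λ j → Holds AF j y (step (guarded g) s)) (holds⇒turn i holds) holds′)
      (x , x∈Q , subst (y attacks_) (holds⇒last i holds) r)

    play-guarded : ∀ g {s} → Guarded s → ∀ k → Guarded (play AF (guarded g) s k)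
    play-guarded g start zero    = start
    play-guarded g start (suc k) = step-guarded g (play-guarded g start k)

    own-member : ∀ {x s} → Guarded s → Holds AF i x s → Member Q Pro x
    own-member (own holds′ m) holds =
      subst (Member Q Pro) (trans (sym (holds⇒last i holds′)) (holds⇒last i holds)) m
    own-member (rival holds′ _) holds = contradiction
      (trans (sym (holds⇒turn (opponent i) holds′)) (holds⇒turn i holds)) (opponent≢ (opponent i))

    rival-member : ∀ {y s} → Guarded s → Holds AF (opponent i) y s → Member Q Opp y
    rival-member (rival holds′ m) holds =
      subst (Member Q Opp)
        (trans (sym (holds⇒last (opponent i) holds′)) (holds⇒last (opponent i) holds)) m
    rival-member (own holds′ _) holds = contradiction
      (trans (sym (holds⇒turn (opponent i) holds)) (holds⇒turn i holds′)) (opponent≢ (opponent i))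

    guard-unblocked : ∀ {s} → Guarded s → Unblocked (opponent i) guarded s
    guard-unblocked start g k x forever
      -- One step suffices: the guard's reply passes the turn back to the rival, while `forever 1`
      -- puts the turn with `i`.
      with _ , _ , holds ← guard-replies g (forever 0)
                             (rival-member (play-guarded g start k) (forever 0))
      = opponent≢ (opponent i)
          (trans (sym (holds⇒turn (opponent i) (forever 1))) (holds⇒turn i holds))

  -- `Disjoint` speaks of `Pro` and `Opp`, the invariant of owner and rival; hence the case split on
  -- `i`.
  guard-disjoint : ∀ {Q} (adm : AdmissibleSet Q) i h {s} → Guarded adm i h s →
                   Disjoint (guarded adm i h) s
  guard-disjoint adm Pro h start x g g′ k k′ pro-x opp-x = ¬both-members adm
    (own-member adm Pro h (play-guarded adm Pro h g start k) pro-x)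
    (rival-member adm Pro h (play-guarded adm Pro h g′ start k′) opp-x)
  guard-disjoint adm Opp h start x g g′ k k′ pro-x opp-x = ¬both-members adm
    (own-member adm Opp h (play-guarded adm Opp h g′ start k′) opp-x)
    (rival-member adm Opp h (play-guarded adm Opp h g start k) pro-x)

  -- Satisfaction in Strategy Logic.

  Assigns : Assignment AF → Profile AF → Set
  Assigns χ π = ∀ v → χ v ≡ just (π v)

  -- `G` and `F` supply their own profile, which agrees with the intended one only pointwise;
  -- equality of plays then avoids function extensionality.
  play-cong : ∀ {π π′} → (∀ v → π v ≡ π′ v) → ∀ s k → play AF π s k ≡ play AF π′ s k
  play-cong eq s zero = refl
  play-cong {π} {π′} eq s (suc k) = trans (cong (step π) (play-cong eq s k))
    (cong (transition AF u) (cong₂ _,_ (cong (λ f → proj₁ f (pro u) (envˢ u)) (eq p))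
      (cong₂ _,_ (cong (λ f → proj₁ f (opp u) (envˢ u)) (eq o)) (cong (λ f → f (envˢ u)) (eq e)))))
    where u = play AF π′ s k

  assigns-unique : ∀ {χ π π′} → Assigns χ π → Assigns χ π′ → ∀ v → π v ≡ π′ v
  assigns-unique as as′ v = just-injective (trans (sym (as v)) (as′ v))

  G⁻ : ∀ {χ π s} φ → Assigns χ π → Sat AF χ s (G φ) → ∀ k → Sat AF χ (play AF π s k) φ
  G⁻ {χ} φ as (π′ , as′ , sat) k =
    subst (λ u → Sat AF χ u φ) (play-cong (assigns-unique {χ} as′ as) _ k) (sat k)

  F⁻ : ∀ {χ π s} φ → Assigns χ π → Sat AF χ s (F φ) → ∃[ k ] Sat AF χ (play AF π s k) φ
  F⁻ {χ} φ as (π′ , as′ , k , sat) =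
    k , subst (λ u → Sat AF χ u φ) (play-cong (assigns-unique {χ} as′ as) _ k) sat

  alternates : Player → Formula AF
  alternates j = ⋀′ λ x → ¬′ G (atom j x)

  module _ {χ : Assignment AF} (v : Var AF) (π : Strategy AF (agent AF v) → Profile AF)
           (as : ∀ f → Assigns (assign AF χ v f) (π f)) where

    χ[_] : Strategy AF (agent AF v) → Assignment AF
    χ[ f ] = assign AF χ v f

    -- The double negation comes from `∀′` being defined through `∃′`; it is harmless wherever the
    -- goal is a contradiction.
    ∀G⁻ : ∀ {s} φ → Sat AF χ s (∀′ AF v (G φ)) →
          ∀ f k → ¬ ¬ Sat AF χ[ f ] (play AF (π f) s k) φ
    ∀G⁻ φ sat f k ¬φ = sat (f , λ sat′ → ¬φ (G⁻ φ (as f) sat′ k))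

    ∀G⁺ : ∀ {s} φ → (∀ f k → Sat AF χ[ f ] (play AF (π f) s k) φ) →
          Sat AF χ s (∀′ AF v (G φ))
    ∀G⁺ φ sat (f , ¬sat) = ¬sat (π f , as f , sat f)

    unblocked⁻ : ∀ j {s} → Sat AF χ s (∀′ AF v (G (alternates j))) → Unblocked j π s
    unblocked⁻ j sat f k x forever =
      ∀G⁻ (alternates j) sat f k λ sat′ → sat′ x (π f , as f , forever)

    unblocked⁺ : ∀ j {s} → Unblocked j π s → Sat AF χ s (∀′ AF v (G (alternates j)))
    unblocked⁺ j unblocked =
      ∀G⁺ (alternates j) λ f k x sat → unblocked f k x (G⁻ (atom j x) (as f) sat)

    disjoint⁻ : ∀ {s} → Sat AF χ s (⋀′ λ x → ∃′ v (F (atom Pro x)) ⇒′ ∀′ AF v (G (¬′ atom Opp x))) →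
                Disjoint π s
    disjoint⁻ sat x f f′ k k′ pro-x opp-x =
      ∀G⁻ (¬′ atom Opp x) (sat x (f , π f , as f , k , pro-x)) f′ k′ λ ¬opp-x → ¬opp-x opp-x

    disjoint⁺ : ∀ {s} → Disjoint π s →
                Sat AF χ s (⋀′ λ x → ∃′ v (F (atom Pro x)) ⇒′ ∀′ AF v (G (¬′ atom Opp x)))
    disjoint⁺ disjoint x (f , sat) with k , pro-x ← F⁻ (atom Pro x) (as f) sat =
      ∀G⁺ (¬′ atom Opp x) λ f′ k′ → disjoint x f f′ k k′ pro-x

  module _ {χ : Assignment AF} {h : Strategy AF Env} (χe : χ e ≡ just h) where

    assigns-p : ∀ {f g} → χ o ≡ just g → Assigns (assign AF χ p f) (duel Opp g f h)
    assigns-p χo p = refl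
    assigns-p χo o = χo
    assigns-p χo e = χe

    assigns-o : ∀ {f g} → χ p ≡ just f → Assigns (assign AF χ o g) (duel Pro f g h)
    assigns-o χp p = χp
    assigns-o χp o = refl
    assigns-o χp e = χe

  module _ {χ : Assignment AF} {h : Strategy AF Env} (χe : χ e ≡ just h) {s x}
           (holds : Holds AF Opp x s) where

    -- The inner game has `Opp` as owner and starts in the middle of a play; `reaches-admissible`
    -- applies at any state, whatever attacks have been seen.
    counter⁻ : Sat AF χ s (∃′ o (φ₃₁ AF ∧′ φ₃₂ AF)) → ¬ ¬ Accepted x
    counter⁻ (g , sat₁ , sat₂) = accepted {Reaches (duels Opp g h s) s Opp}
      -- Any strategy of `Pro` would do, since `x` already holds after zero steps.
      (guard ∅ Pro , 0 , holds)
      (reaches-admissible Opp g h s (unblocked⁻ p _ as Pro sat₁) (disjoint⁻ p _ as sat₂))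
      where
      as : ∀ f → Assigns (assign AF (assign AF χ o g) p f) (duel Opp g f h)
      as f = assigns-p χe refl

    counter⁺ : Accepted x → Sat AF χ s (∃′ o (φ₃₁ AF ∧′ φ₃₂ AF))
    counter⁺ (Q , x∈Q , adm) = guard Q Opp ,
      unblocked⁺ p _ as Pro (guard-unblocked adm Opp h (own holds x∈Q)) ,
      disjoint⁺ p _ as (guard-disjoint adm Opp h (own holds x∈Q))
      where
      as : ∀ f → Assigns (assign AF (assign AF χ o (guard Q Opp)) p f) (duel Opp (guard Q Opp) f h)
      as f = assigns-p χe refl

  opp-unaccepted : Formula AF
  opp-unaccepted = ⋁′ (λ x → atom Opp x) ⇒′ ¬′ ∃′ o (φ₃₁ AF ∧′ φ₃₂ AF)

  initial-holds : ∀ a → Holds AF Pro a (initial AF a)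
  initial-holds a = refl , refl , refl

  ideal⇒true : ∀ {a} → ∃ (Ideal a) → TrueInIS AF a (idealFormula AF)
  ideal⇒true {a} (Q , a∈Q , adm , safe′) = guard Q Pro , λ (h , ¬sat) → ¬sat (body h)
    where
    body : ∀ h → Sat AF (assign AF (assign AF (emptyAssignment AF) p (guard Q Pro)) e h)
                     (initial AF a) (φ₁ AF ∧′ φ₂ AF ∧′ φ₃ AF)
    body h =
      unblocked⁺ o _ as Opp (guard-unblocked adm Pro h start) ,
      disjoint⁺ o _ as (guard-disjoint adm Pro h start) ,
      -- By the invariant, whatever `Opp` plays attacks `Q`, so it cannot be accepted.
      ∀G⁺ o _ as opp-unaccepted λ { g k (x , holds) counter →
        let y , y∈Q , r = rival-member adm Pro h (play-guarded adm Pro h g start k) holds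
        in counter⁻ refl holds counter (safe′ y x y∈Q r) }
      where
      start : Guarded adm Pro h (initial AF a)
      start = own (initial-holds a) a∈Q
      as : ∀ g → Assigns _ (duel Pro (guard Q Pro) g h)
      as g = assigns-o refl refl

  -- Since `∀′ e` yields its body only under double negation, the decidability of the goal is used.
  -- An attacker of a reached argument is reached by `Opp`; were it accepted, `counter⁺` would
  -- refute `φ₃` at that state.
  true⇒ideal : ∀ {a} → TrueInIS AF a (idealFormula AF) → ∃ (Ideal a)
  true⇒ideal {a} (f , sat) = decidable-stable (ideal? a)
    λ ¬ideal → sat (h , λ (sat₁ , sat₂ , sat₃) → ¬ideal (ideal
      (guard ∅ Opp , 0 , initial-holds a)
      (reaches-admissible Pro f h s (unblocked⁻ o _ as Opp sat₁) (disjoint⁻ o _ as sat₂))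
      λ x y reached r acc →
        let g , k , holds = reaches-attackers Pro f h s reached r
        in ∀G⁻ o _ as opp-unaccepted sat₃ g k λ safe′ → safe′ (y , holds) (counter⁺ refl holds acc)))
    where
    s : State
    s = initial AF a
    h : Strategy AF Env
    h _ = noop
    as : ∀ g → Assigns _ (duel Pro f g h)
    as g = assigns-o refl refl

theorem4p3 : (AF : Framework) (a : Framework.Args AF) →
    ∃ (λ σ → IdealWinning AF a σ) ⇔ TrueInIS AF a (idealFormula AF)
theorem4p3 AF a = mk⇔ (λ (_ , w) → ideal⇒true AF (idealWinning⇒ideal AF w))
                      (ideal⇒idealWinning AF ∘ true⇒ideal AF)
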